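{- For any bounded lattice $L$ and binary operation $\to$ on $L$, the following are equivalent: 1. $\to$ is a Heyting implication, i.e., for all $a,b,c\in L$, $a\wedge b\leq c$ iff $a\leq b\to c$; 2. $\to$ is a preconditional satisfying modus ponens and weak monotonicity; 3. $\to$ satisfies modus ponens, weak monotonicity, and, for all $a,b,c\in L$, both $a\to b\leq a\to(a\wedge b)$ and $a\to(b\wedge c)\leq a\to b$.
   Context: A preconditional on a bounded lattice $L$ is a binary operation $\to$ on $L$ such that for all $a,b,c\in L$: (1) $1\to a\leq a$; (2) $a\wedge b\leq a\to b$; (3) $a\to b\leq a\to(a\wedge b)$; (4) $a\to(b\wedge c)\leq a\to b$; (5) $a\to((a\wedge b)\to c)\leq (a\wedge b)\to c$. Modus ponens: $a\wedge(a\to b)\leq b$ for all $a,b\in L$. Weak monotonicity: $b\leq a\to b$ for all $a,b\in L$. -}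

module Defs where

open import Level using (Level; _⊔_)
open import Algebra.Core using (Op₂)
open import Relation.Binary.Lattice using (BoundedLattice)

module _ {c ℓ₁ ℓ₂ : Level} (L : BoundedLattice c ℓ₁ ℓ₂)
         (_⇨_ : Op₂ (BoundedLattice.Carrier L)) where

  open BoundedLattice L using (Carrier; _≤_; _∧_; ⊤)

  record IsPreconditional : Set (c ⊔ ℓ₂) where
    field
      ⊤⇨-≤        : ∀ a → (⊤ ⇨ a) ≤ a
      ∧-≤-⇨       : ∀ a b → (a ∧ b) ≤ (a ⇨ b)
      ⇨-≤-⇨∧      : ∀ a b → (a ⇨ b) ≤ (a ⇨ (a ∧ b))
      ⇨∧-≤-⇨      : ∀ a b d → (a ⇨ (b ∧ d)) ≤ (a ⇨ b)
      ⇨∧⇨-≤-∧⇨    : ∀ a b d → (a ⇨ ((a ∧ b) ⇨ d)) ≤ ((a ∧ b) ⇨ d)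

  ModusPonens : Set (c ⊔ ℓ₂)
  ModusPonens = ∀ a b → (a ∧ (a ⇨ b)) ≤ b

  WeakMonotonicity : Set (c ⊔ ℓ₂)
  WeakMonotonicity = ∀ a b → b ≤ (a ⇨ b)

-- The only substantial implication is 3 ⇒ 1.  If w ∧ x ≤ y, then x ∧ w = y ∧ (x ∧ w), so
--   w ≤ x ⇨ w ≤ x ⇨ (x ∧ w) = x ⇨ (y ∧ (x ∧ w)) ≤ x ⇨ y;
-- the converse is modus ponens.

module Submission where

open import Defs
open import Level using (Level)
open import Data.Product using (_×_; _,_)
open import Function.Base using (_∘_)
open import Function.Bundles using (_⇔_; mk⇔)
open import Algebra.Core using (Op₂)
open import Algebra.Definitions using (Congruent₂)
open import Relation.Binary.Lattice using (BoundedLattice; HeytingAlgebra; Exponential)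
import Relation.Binary.Lattice.Properties.HeytingAlgebra as HeytingAlgebraProperties
import Relation.Binary.Lattice.Properties.MeetSemilattice as MeetSemilatticeProperties
import Relation.Binary.Reasoning.PartialOrder as ≤-Reasoning

-- In a Heyting algebra the required inequalities follow from residuation, evaluation and
-- monotonicity in the consequent. Passing from 2 to 3 merely selects axioms. For the return to 1,
-- the two remaining axioms supply what residuation needs: one allows the antecedent to be assumed
-- inside the consequent, the other is monotonicity in the consequent in disguise, because `b ≤ c`
-- means that `b` equals `c ∧ b`.

module _ {c ℓ₁ ℓ₂ : Level} (L : BoundedLattice c ℓ₁ ℓ₂)
         (_⇨_ : Op₂ (BoundedLattice.Carrier L)) where

  open BoundedLattice L
  open MeetSemilatticeProperties meetSemilattice using (∧-comm; ∧-monotonic; y≤x⇒x∧y≈y)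

  module _ (exponential : Exponential _≤_ _∧_ _⇨_) where

    private
      heytingAlgebra : HeytingAlgebra c ℓ₁ ℓ₂
      heytingAlgebra = record
        { isHeytingAlgebra = record
          { isBoundedLattice = isBoundedLattice
          ; exponential      = exponential
          }
        }

    open HeytingAlgebra heytingAlgebra using (transpose-⇨)
    open HeytingAlgebraProperties heytingAlgebra
      using (⇨-eval; ⇨-applyʳ; ⇨ʳ-covariant; y≤x⇨y)

    exponential⇒modusPonens : ModusPonens L _⇨_
    exponential⇒modusPonens a b = ⇨-applyʳ refl

    exponential⇒weakMonotonicity : WeakMonotonicity L _⇨_
    exponential⇒weakMonotonicity a b = y≤x⇨y

    exponential⇒isPreconditional : IsPreconditional L _⇨_
    exponential⇒isPreconditional = record
      { ⊤⇨-≤     = λ a → trans (∧-greatest refl (maximum _)) ⇨-eval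
      ; ∧-≤-⇨    = λ a b → trans (x∧y≤y a b) y≤x⇨y
      ; ⇨-≤-⇨∧   = λ a b → transpose-⇨ (∧-greatest (x∧y≤y _ _) ⇨-eval)
      ; ⇨∧-≤-⇨   = λ a b d → ⇨ʳ-covariant (x∧y≤x b d)
      -- After transposing, `a ∧ b` is used twice: weakened to `a` it evaluates the outer
      -- implication, and a retained copy evaluates the inner one.
      ; ⇨∧⇨-≤-∧⇨ = λ a b d → transpose-⇨
          (trans (∧-greatest (trans (∧-monotonic refl (x∧y≤x a b)) ⇨-eval) (x∧y≤y _ _)) ⇨-eval)
      }

  -- Equality is the setoid relation `_≈_`, so congruence of `_⇨_`, automatic for an operation on an
  -- ordinary set, is an explicit hypothesis.
  weakened⇒exponential :
    Congruent₂ _≈_ _⇨_ → ModusPonens L _⇨_ → WeakMonotonicity L _⇨_ →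
    (∀ a b → (a ⇨ b) ≤ (a ⇨ (a ∧ b))) → (∀ a b d → (a ⇨ (b ∧ d)) ≤ (a ⇨ b)) →
    Exponential _≤_ _∧_ _⇨_
  weakened⇒exponential ⇨-cong mp wm ⇨-≤-⇨∧ ⇨∧-≤-⇨ w x y = curry , uncurry
    where
    open ≤-Reasoning poset

    curry : (w ∧ x) ≤ y → w ≤ (x ⇨ y)
    curry w∧x≤y = begin
      w                  ≤⟨ wm x w ⟩
      x ⇨ w              ≤⟨ ⇨-≤-⇨∧ x w ⟩
      -- Writing the consequent as a meet with `y` lets `⇨∧-≤-⇨` act as monotonicity.
      x ⇨ (x ∧ w)        ≈⟨ ⇨-cong Eq.refl (y≤x⇒x∧y≈y x∧w≤y) ⟨
      x ⇨ (y ∧ (x ∧ w))  ≤⟨ ⇨∧-≤-⇨ x y (x ∧ w) ⟩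
      x ⇨ y              ∎
      where
      x∧w≤y : (x ∧ w) ≤ y
      x∧w≤y = trans (reflexive (∧-comm x w)) w∧x≤y

    uncurry : w ≤ (x ⇨ y) → (w ∧ x) ≤ y
    uncurry w≤x⇨y = begin
      w ∧ x        ≤⟨ ∧-monotonic w≤x⇨y refl ⟩
      (x ⇨ y) ∧ x  ≈⟨ ∧-comm (x ⇨ y) x ⟩
      x ∧ (x ⇨ y)  ≤⟨ mp x y ⟩
      y            ∎

proposition3 :
    {c ℓ₁ ℓ₂ : Level} (L : BoundedLattice c ℓ₁ ℓ₂) →
    let open BoundedLattice L in
    (_⇨_ : Op₂ Carrier) → Congruent₂ _≈_ _⇨_ →
    let Heyting = Exponential _≤_ _∧_ _⇨_
        PreconditionalMPWM = IsPreconditional L _⇨_ × ModusPonens L _⇨_ × WeakMonotonicity L _⇨_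
        Weakened = ModusPonens L _⇨_ × WeakMonotonicity L _⇨_
          × (∀ a b → (a ⇨ b) ≤ (a ⇨ (a ∧ b)))
          × (∀ a b d → (a ⇨ (b ∧ d)) ≤ (a ⇨ b))
    in (Heyting ⇔ PreconditionalMPWM) × (PreconditionalMPWM ⇔ Weakened) × (Heyting ⇔ Weakened)
proposition3 L _⇨_ ⇨-cong =
  -- Each missing direction is the composite of the other two arrows of the cycle.
  mk⇔ 1⇒2 (3⇒1 ∘ 2⇒3) , mk⇔ 2⇒3 (1⇒2 ∘ 3⇒1) , mk⇔ (2⇒3 ∘ 1⇒2) 3⇒1
  where
  open BoundedLattice L

  Heyting            = Exponential _≤_ _∧_ _⇨_
  PreconditionalMPWM = IsPreconditional L _⇨_ × ModusPonens L _⇨_ × WeakMonotonicity L _⇨_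
  Weakened           = ModusPonens L _⇨_ × WeakMonotonicity L _⇨_
    × (∀ a b → (a ⇨ b) ≤ (a ⇨ (a ∧ b)))
    × (∀ a b d → (a ⇨ (b ∧ d)) ≤ (a ⇨ b))

  1⇒2 : Heyting → PreconditionalMPWM
  1⇒2 h = exponential⇒isPreconditional L _⇨_ h
        , exponential⇒modusPonens L _⇨_ h
        , exponential⇒weakMonotonicity L _⇨_ h

  2⇒3 : PreconditionalMPWM → Weakened
  2⇒3 (p , mp , wm) = mp , wm , ⇨-≤-⇨∧ , ⇨∧-≤-⇨
    where open IsPreconditional p

  3⇒1 : Weakened → Heyting
  3⇒1 (mp , wm , ⇨-≤-⇨∧ , ⇨∧-≤-⇨) = weakened⇒exponential L _⇨_ ⇨-cong mp wm ⇨-≤-⇨∧ ⇨∧-≤-⇨
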